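{- Let $\lambda\geq\aleph_0$ be a cardinal. Then, considering groups up to isomorphism of abstract groups, $\mathrm{Aut}(\mathbf{K}^{\lambda}_{\mathrm{gf}})\neq\mathrm{Aut}(\mathbf{K}^{\lambda}_{\mathrm{lf}})$; that is, the class of groups isomorphic to the automorphism group of some graph with domain $\lambda$ is different from the class of groups isomorphic to the automorphism group of some locally finite group with domain $\lambda$.
   Context: $\mathbf{K}_{\mathrm{lf}}$ denotes the class of locally finite groups (groups in which every finitely generated subgroup is finite), and $\mathbf{K}_{\mathrm{gf}}$ denotes the class of graphs. For a class $\mathbf{K}$ of structures and an infinite cardinal $\lambda$, $\mathbf{K}^{\lambda}=\{M\in\mathbf{K} : \text{the domain of } M \text{ is } \lambda\}$ and $\mathrm{Aut}(\mathbf{K})=\{\mathrm{Aut}(M) : M\in\mathbf{K}\}$. -}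

module Defs where

open import Algebra.Bundles using (Group; RawGroup)
open import Algebra.Core using (Op₁; Op₂)
open import Algebra.Morphism.Structures
  using (IsGroupHomomorphism; IsGroupIsomorphism)
open import Algebra.Structures using (IsGroup)
open import Data.List.Base using (List)
open import Data.List.Membership.Propositional using (_∈_)
open import Data.Nat.Base using (ℕ)
open import Data.Product.Base using (Σ; Σ-syntax; ∃-syntax; _×_; _,_)
open import Function.Bundles using (_↔_; _↣_; _⇔_; Inverse; Equivalence; mk⇔)
open import Function.Construct.Composition using (inverse)
open import Function.Construct.Identity using (↔-id)
open import Function.Construct.Symmetry using (↔-sym)
open import Function.Definitions using (Injective)
open import Induction.WellFounded using (WellFounded)
open import Level using (Level; suc)
open import Relation.Binary.Core using (Rel)
open import Relation.Binary.Definitions using (Symmetric; Irreflexive)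
open import Relation.Binary.PropositionalEquality
open import Relation.Binary.Structures using (IsStrictTotalOrder)
open import Relation.Nullary.Negation using (¬_)
open import Relation.Unary using (Pred)

-- A cardinal is an initial ordinal: a well-order that is not equinumerous
-- with any of its proper initial segments.  Equinumerosity with a segment is
-- phrased by an injection whose range is the segment, rather than by a
-- bijection with the type Σ[ x ∈ Carrier ] x < a, because the latter would also
-- count the proofs of x < a.
record InfiniteCardinal (ℓ : Level) : Set (suc ℓ) where
  infix 4 _<_
  field
    Carrier            : Set ℓ
    _<_                : Rel Carrier ℓ
    isStrictTotalOrder : IsStrictTotalOrder _≡_ _<_
    <-wellFounded      : WellFounded _<_
    initial            : ∀ a → ¬ (Σ[ f ∈ (Carrier → Carrier) ]
                           (Injective _≡_ _≡_ f ×
                            (∀ y → (∃[ x ] f x ≡ y) ⇔ (y < a))))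
    ℵ₀≤                : ℕ ↣ Carrier

record Graph {ℓ} (V : Set ℓ) : Set (suc ℓ) where
  field
    Edge        : Rel V ℓ
    symmetric   : Symmetric Edge
    irreflexive : Irreflexive _≡_ Edge

module _ {ℓ} (G : RawGroup ℓ ℓ) where
  open RawGroup G

  data ⟨_⟩ (xs : List Carrier) : Pred Carrier ℓ where
    gen  : ∀ {x} → x ∈ xs → ⟨ xs ⟩ x
    unit : ⟨ xs ⟩ ε
    mult : ∀ {x y} → ⟨ xs ⟩ x → ⟨ xs ⟩ y → ⟨ xs ⟩ (x ∙ y)
    inv  : ∀ {x} → ⟨ xs ⟩ x → ⟨ xs ⟩ (x ⁻¹)

Finite : ∀ {ℓ} {A : Set ℓ} → Pred A ℓ → Set ℓ
Finite {A = A} P = ∃[ ys ] (∀ (y : A) → P y ⇔ (y ∈ ys))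

record LocallyFiniteGroup {ℓ} (V : Set ℓ) : Set ℓ where
  infixl 7 _∙_
  infix  8 _⁻¹
  field
    _∙_     : Op₂ V
    ε       : V
    _⁻¹     : Op₁ V
    isGroup : IsGroup _≡_ _∙_ ε _⁻¹

  rawGroup : RawGroup ℓ ℓ
  rawGroup = record { _≈_ = _≡_ ; _∙_ = _∙_ ; ε = ε ; _⁻¹ = _⁻¹ }

  field
    locallyFinite : ∀ (xs : List V) → Finite (⟨_⟩ rawGroup xs)

infixr 9 _∘↔_
_∘↔_ : ∀ {ℓ} {V : Set ℓ} → V ↔ V → V ↔ V → V ↔ V
π ∘↔ ρ = inverse ρ π

-- The group of all permutations of V satisfying P, under composition, where
-- permutations are identified when they agree pointwise.
permutationGroup : ∀ {ℓ} {V : Set ℓ} (P : Pred (V ↔ V) ℓ) →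
                   P (↔-id V) →
                   (∀ {π ρ} → P π → P ρ → P (π ∘↔ ρ)) →
                   (∀ {π} → P π → P (↔-sym π)) →
                   Group ℓ ℓ
permutationGroup {V = V} P P-id P-∘ P-sym = record
  { Carrier = Σ (V ↔ V) P
  ; _≈_     = λ (π , _) (ρ , _) → ∀ x → to π x ≡ to ρ x
  ; _∙_     = λ (π , p) (ρ , r) → π ∘↔ ρ , P-∘ p r
  ; ε       = ↔-id V , P-id
  ; _⁻¹     = λ (π , p) → ↔-sym π , P-sym p
  ; isGroup = record
    { isMonoid = record
      { isSemigroup = record
        { isMagma = record
          { isEquivalence = record
            { refl  = λ _ → refl
            ; sym   = λ e x → sym (e x)
            ; trans = λ e f x → trans (e x) (f x)
            }
          ; ∙-cong = λ {_} {(π′ , _)} {(ρ , _)} e f x →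
                       trans (e (to ρ x)) (cong (to π′) (f x))
          }
        ; assoc = λ _ _ _ _ → refl
        }
      ; identity = (λ _ _ → refl) , (λ _ _ → refl)
      }
    ; inverse = (λ (π , _) → Inverse.strictlyInverseʳ π)
              , (λ (π , _) → Inverse.strictlyInverseˡ π)
    ; ⁻¹-cong = λ {(π , _)} {(ρ , _)} e x →
        trans (cong (from π) (sym (trans (e (from ρ x))
                                         (Inverse.strictlyInverseˡ ρ x))))
              (Inverse.strictlyInverseʳ π (from ρ x))
    }
  }
  where open Inverse using (to; from)

module _ {ℓ} {V : Set ℓ} where
  open Inverse using (to; from; strictlyInverseˡ; strictlyInverseʳ)

  AutGraph : Graph V → Group ℓ ℓ
  AutGraph Γ = permutationGroup preservesEdges
    (λ _ _ → mk⇔ (λ e → e) (λ e → e))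
    (λ {_} {ρ} p r x y →
      mk⇔ (λ e → Equivalence.to (p (to ρ x) (to ρ y)) (Equivalence.to (r x y) e))
          (λ e → Equivalence.from (r x y) (Equivalence.from (p (to ρ x) (to ρ y)) e)))
    (λ {π} p x y →
      mk⇔ (λ e → Equivalence.from (p (from π x) (from π y))
                   (subst₂ Edge (sym (strictlyInverseˡ π x))
                                (sym (strictlyInverseˡ π y)) e))
          (λ e → subst₂ Edge (strictlyInverseˡ π x) (strictlyInverseˡ π y)
                   (Equivalence.to (p (from π x) (from π y)) e)))
    where
    open Graph Γ using (Edge)
    preservesEdges : Pred (V ↔ V) ℓ
    preservesEdges π = ∀ x y → Edge x y ⇔ Edge (to π x) (to π y)

  AutGroup : LocallyFiniteGroup V → Group ℓ ℓ
  AutGroup G = permutationGroup isAutomorphism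
    (homomorphism (λ _ _ → refl) refl (λ _ → refl))
    (λ {π} {ρ} p r → let module p = IsGroupHomomorphism p
                         module r = IsGroupHomomorphism r in
      homomorphism
        (λ x y → trans (cong (to π) (r.homo x y)) (p.homo (to ρ x) (to ρ y)))
        (trans (cong (to π) r.ε-homo) p.ε-homo)
        (λ x → trans (cong (to π) (r.⁻¹-homo x)) (p.⁻¹-homo (to ρ x))))
    (λ {π} p → let module p = IsGroupHomomorphism p
                   adjoint : ∀ {x y} → to π x ≡ y → from π y ≡ x
                   adjoint e = trans (cong (from π) (sym e)) (strictlyInverseʳ π _)
               in
      homomorphism
        (λ x y → adjoint (trans (p.homo (from π x) (from π y))
                           (cong₂ _∙_ (strictlyInverseˡ π x) (strictlyInverseˡ π y))))
        (adjoint p.ε-homo)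
        (λ x → adjoint (trans (p.⁻¹-homo (from π x))
                         (cong _⁻¹ (strictlyInverseˡ π x)))))
    where
    open LocallyFiniteGroup G using (_∙_; ε; _⁻¹; rawGroup)
    isAutomorphism : Pred (V ↔ V) ℓ
    isAutomorphism π = IsGroupHomomorphism rawGroup rawGroup (to π)

    homomorphism : ∀ {f : V → V} → (∀ x y → f (x ∙ y) ≡ f x ∙ f y) →
                   f ε ≡ ε → (∀ x → f (x ⁻¹) ≡ f x ⁻¹) →
                   IsGroupHomomorphism rawGroup rawGroup f
    homomorphism {f} ∙-homo ε-homo ⁻¹-homo = record
      { isMonoidHomomorphism = record
        { isMagmaHomomorphism = record
          { isRelHomomorphism = record { cong = cong f }
          ; homo = ∙-homo
          }
        ; ε-homo = ε-homo
        }
      ; ⁻¹-homo = ⁻¹-homo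
      }

infix 4 _≅_
_≅_ : ∀ {ℓ} → Group ℓ ℓ → Group ℓ ℓ → Set ℓ
H ≅ K = Σ[ f ∈ (Group.Carrier H → Group.Carrier K) ]
          IsGroupIsomorphism (Group.rawGroup H) (Group.rawGroup K) f

module _ {ℓ} (κ : InfiniteCardinal ℓ) where
  open InfiniteCardinal κ using (Carrier)

  Aut-𝐊gf : Pred (Group ℓ ℓ) (suc ℓ)
  Aut-𝐊gf H = Σ[ Γ ∈ Graph Carrier ] H ≅ AutGraph Γ

  Aut-𝐊lf : Pred (Group ℓ ℓ) ℓ
  Aut-𝐊lf H = Σ[ G ∈ LocallyFiniteGroup Carrier ] H ≅ AutGroup G

{-# OPTIONS --safe #-}

-- The trivial group separates the two classes.
--
-- On a well-order without a greatest element, call x even or odd according to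
-- its distance from the last limit point below it, and join x < y by an edge
-- iff x is even.  If an automorphism fixes everything below x, then it moves x
-- to a vertex adjacent to all others above x (x even) or to none of them (x
-- odd), and x is the only such vertex; so the graph is rigid.
--
-- A group without non-trivial automorphisms is abelian (conjugations are
-- trivial) of exponent 2 (inversion is trivial).  If it is also well-ordered
-- and has elements ε, a, c, all distinct, then the elements x outside the span
-- of a and of all y < x span a subgroup K of index 2 avoiding a.  It contains
-- some v ≢ ε, and the transvection fixing K and mapping x to v ∙ x outside K is
-- a non-trivial automorphism.
module Submission where

open import Algebra.Bundles using (Group; CommutativeSemigroup)
import Algebra.Properties.CommutativeSemigroup as CommutativeSemigroupProperties
import Algebra.Properties.Group as GroupProperties
open import Algebra.Morphism.Construct.Identity using (isGroupIsomorphism)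
open import Algebra.Morphism.Structures using (IsGroupIsomorphism)
open import Axiom.ExcludedMiddle using (ExcludedMiddle)
open import Data.Bool.Base using (Bool; true; false; not)
open import Data.Empty using (⊥; ⊥-elim)
open import Data.Nat.Base as ℕ using (ℕ; zero)
import Data.Nat.Properties as ℕ
open import Data.Product.Base using (Σ-syntax; ∃; ∃-syntax; _×_; _,_; proj₁; proj₂)
open import Data.Sum.Base using (_⊎_; inj₁; inj₂; swap)
open import Function.Bundles using (_↔_; _⇔_; Inverse; Equivalence; Injection; mk⇔; mk↔ₛ′)
open import Function.Definitions using (Injective)
open import Induction.WellFounded using (WellFounded; Acc; acc)
open import Level using (Level)
open import Relation.Binary.Core using (Rel)
open import Relation.Binary.Definitions using (tri<; tri≈; tri>)
open import Relation.Binary.PropositionalEquality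
open import Relation.Binary.Structures using (IsStrictTotalOrder)
open import Relation.Nullary.Decidable.Core using (Dec; yes; no)
open import Relation.Nullary.Negation using (¬_; contradiction)
open import Relation.Unary using (Pred; _≐_)
open import Defs

-- Hilbert's hotel: shifting along an injective sequence.

module _ {ℓ} (em : ExcludedMiddle ℓ) {V : Set ℓ} where

  module _ (c : ℕ → V) (c-injective : Injective _≡_ _≡_ c) where

    shift-dec : ∀ x → Dec (∃[ n ] c n ≡ x) → V
    shift-dec x (yes (n , _)) = c (ℕ.suc n)
    shift-dec x (no _)        = x

    shift : V → V
    shift x = shift-dec x em

    shift-injective : Injective _≡_ _≡_ shift
    shift-injective {x} {y} e with em {∃[ n ] c n ≡ x} | em {∃[ n ] c n ≡ y}
    ... | yes (n , refl) | yes (m , refl) = cong c (ℕ.suc-injective (c-injective e))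
    ... | yes (n , _)    | no y∉c         = contradiction (ℕ.suc n , e) y∉c
    ... | no x∉c         | yes (m , _)    = contradiction (ℕ.suc m , sym e) x∉c
    ... | no _           | no _           = e

    shift≢c₀ : ∀ x → shift x ≢ c 0
    shift≢c₀ x e with em {∃[ n ] c n ≡ x}
    ... | yes _  = contradiction (c-injective e) λ ()
    ... | no x∉c = x∉c (0 , sym e)

    shift-c : ∀ n → shift (c n) ≡ c (ℕ.suc n)
    shift-c n with em {∃[ m ] c m ≡ c n}
    ... | yes (m , e) = cong (λ k → c (ℕ.suc k)) (c-injective e)
    ... | no c∉c      = contradiction (n , refl) c∉c

    shift-surjective : ∀ y → y ≢ c 0 → ∃[ x ] shift x ≡ y
    shift-surjective y y≢c₀ with em {∃[ n ] c n ≡ y}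
    ... | yes (zero , e)    = contradiction (sym e) y≢c₀
    ... | yes (ℕ.suc n , e) = c n , trans (shift-c n) e
    ... | no y∉c            = y , fixed
      where
      fixed : shift y ≡ y
      fixed with em {∃[ n ] c n ≡ y}
      ... | yes y∈c = contradiction y∈c y∉c
      ... | no _    = refl

  -- If `m` occurs in the sequence, drop the terms before it; otherwise prepend it.
  injection-starting-at : (e : ℕ → V) → Injective _≡_ _≡_ e → ∀ m →
    Σ[ c ∈ (ℕ → V) ] (Injective _≡_ _≡_ c × c 0 ≡ m)
  injection-starting-at e e-injective m with em {∃[ k ] e k ≡ m}
  ... | yes (k , eₖ≡m) =
    (λ n → e (k ℕ.+ n)) , (λ p → ℕ.+-cancelˡ-≡ k _ _ (e-injective p)) ,
    trans (cong e (ℕ.+-identityʳ k)) eₖ≡m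
  ... | no m∉e = c , c-injective , refl
    where
    c : ℕ → V
    c zero      = m
    c (ℕ.suc n) = e n
    c-injective : Injective _≡_ _≡_ c
    c-injective {zero}    {zero}    _ = refl
    c-injective {zero}    {ℕ.suc y} p = contradiction (y , sym p) m∉e
    c-injective {ℕ.suc x} {zero}    p = contradiction (x , p) m∉e
    c-injective {ℕ.suc x} {ℕ.suc y} p = cong ℕ.suc (e-injective p)

-- Infinite cardinals are limit ordinals.

module _ {ℓ} (em : ExcludedMiddle ℓ) (κ : InfiniteCardinal ℓ) where
  open InfiniteCardinal κ
  open IsStrictTotalOrder isStrictTotalOrder using (irrefl; compare)

  -- If `m` were greatest, the elements other than `m` would form the segment below `m`. The shift
  -- along a sequence starting at `m` has exactly this range, contradicting `initial`.
  no-greatest : ∀ m → ∃[ y ] m < y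
  no-greatest m with em {∃[ y ] m < y}
  ... | yes m<y = m<y
  ... | no m≮ with injection-starting-at em (Injection.to ℵ₀≤) (Injection.injective ℵ₀≤) m
  ...   | c , c-injective , refl =
    ⊥-elim (initial m (shift em c c-injective , shift-injective em c c-injective , range))
    where
    range : ∀ y → (∃[ x ] shift em c c-injective x ≡ y) ⇔ (y < m)
    range y = mk⇔ below (λ y<m → shift-surjective em c c-injective y (λ e → irrefl e y<m))
      where
      below : ∃[ x ] shift em c c-injective x ≡ y → y < m
      below (x , e) with compare y m
      ... | tri< y<m _ _ = y<m
      ... | tri≈ _ y≡m _ = contradiction (trans e y≡m) (shift≢c₀ em c c-injective x)
      ... | tri> _ _ m<y = contradiction (y , m<y) m≮

-- Parity on a well-order and a rigid graph.

module _ {ℓ} (em : ExcludedMiddle ℓ) {V : Set ℓ} {_<_ : Rel V ℓ}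
         (<-isStrictTotalOrder : IsStrictTotalOrder _≡_ _<_)
         (<-wellFounded : WellFounded _<_)
         (no-max : ∀ x → ∃[ y ] x < y)
  where
  open IsStrictTotalOrder <-isStrictTotalOrder using (irrefl; asym; compare)
    renaming (trans to <-trans)

  least : (P : Pred V ℓ) → ∃ P → ∃[ m ] (P m × ∀ {y} → y < m → ¬ P y)
  least P (x , Px) = go x (<-wellFounded x) Px
    where
    go : ∀ x → Acc _<_ x → P x → ∃[ m ] (P m × ∀ {y} → y < m → ¬ P y)
    go x (acc rs) Px with em {∃[ y ] (y < x × P y)}
    ... | yes (y , y<x , Py) = go y (rs y<x) Py
    ... | no none            = x , Px , λ y<x Py → none (_ , y<x , Py)

  infix 4 _⋖_
  _⋖_ : Rel V ℓ
  x ⋖ y = x < y × ∀ {z} → z < y → ¬ x < z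

  ⋖-exists : ∀ x → ∃[ y ] x ⋖ y
  ⋖-exists x = least (x <_) (no-max x)

  ⋖-injective : ∀ {x y z} → x ⋖ z → y ⋖ z → x ≡ y
  ⋖-injective {x} {y} (x<z , x-max) (y<z , y-max) with compare x y
  ... | tri< x<y _ _ = contradiction x<y (x-max y<z)
  ... | tri≈ _ x≡y _ = x≡y
  ... | tri> _ _ y<x = contradiction y<x (y-max x<z)

  -- `true` stands for even. The least element has no immediate predecessor, so it counts as a limit
  -- and is even.
  data Parity : Bool → Pred V ℓ where
    limit     : ∀ {x} → (∀ y → ¬ y ⋖ x) → Parity true x
    successor : ∀ {x y b} → y ⋖ x → Parity b y → Parity (not b) x

  parity : ∀ x → Parity true x ⊎ Parity false x
  parity x = go (<-wellFounded x)
    where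
    go : ∀ {x} → Acc _<_ x → Parity true x ⊎ Parity false x
    go {x} (acc rs) with em {∃[ y ] y ⋖ x}
    ... | no none = inj₁ (limit λ y y⋖x → none (y , y⋖x))
    ... | yes (y , y⋖x) with go (rs (proj₁ y⋖x))
    ...   | inj₁ even = inj₂ (successor y⋖x even)
    ...   | inj₂ odd  = inj₁ (successor y⋖x odd)

  parity-unique : ∀ {b b′ x} → Parity b x → Parity b′ x → b ≡ b′
  parity-unique (limit _)         (limit _)          = refl
  parity-unique (limit none)      (successor y⋖x _)  = contradiction y⋖x (none _)
  parity-unique (successor y⋖x _) (limit none)       = contradiction y⋖x (none _)
  parity-unique (successor y⋖x p) (successor y′⋖x p′) with ⋖-injective y⋖x y′⋖x
  ... | refl = cong not (parity-unique p p′)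

  thresholdGraph : Graph V
  thresholdGraph = record
    { Edge        = λ x y → (x < y × Parity true x) ⊎ (y < x × Parity true y)
    ; symmetric   = swap
    ; irreflexive = λ { x≡y (inj₁ (x<y , _)) → irrefl x≡y x<y
                      ; x≡y (inj₂ (y<x , _)) → irrefl (sym x≡y) y<x }
    }

  open Graph thresholdGraph using (Edge)

  edge⇒even : ∀ {x y} → x < y → Edge x y → Parity true x
  edge⇒even x<y (inj₁ (_ , even)) = even
  edge⇒even x<y (inj₂ (y<x , _))  = contradiction y<x (asym x<y)

  even-odd-disjoint : ∀ {x} → Parity true x → Parity false x → ⊥
  even-odd-disjoint even odd with parity-unique even odd
  ... | ()

  module _ (π : V ↔ V) (π-edge : ∀ x y → Edge x y ⇔ Edge (Inverse.to π x) (Inverse.to π y)) where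
    open Inverse π using (to; from; strictlyInverseˡ; strictlyInverseʳ)

    to-injective : ∀ {x y} → to x ≡ to y → x ≡ y
    to-injective e = trans (sym (strictlyInverseʳ _)) (trans (cong from e) (strictlyInverseʳ _))

    module _ {x} (fixed : ∀ {y} → y < x → to y ≡ y) where

      -- Lets adjacency questions above `x` be pulled back along `π`: a preimage below `x` would be
      -- fixed, hence equal to `w`.
      from≮ : ∀ {w} → ¬ w < x → ¬ from w < x
      from≮ {w} w≮x u<x =
        w≮x (subst (_< x) (trans (sym (fixed u<x)) (strictlyInverseˡ w)) u<x)

      even-adjacent-above : Parity true x → ∀ {w} → ¬ w < x → w ≢ to x → Edge (to x) w
      even-adjacent-above even {w} w≮x w≢ with compare x (from w)
      ... | tri< x<u _ _ = subst (Edge (to x)) (strictlyInverseˡ w)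
                             (Equivalence.to (π-edge x (from w)) (inj₁ (x<u , even)))
      ... | tri≈ _ x≡u _ = contradiction (sym (trans (cong to x≡u) (strictlyInverseˡ w))) w≢
      ... | tri> _ _ u<x = contradiction u<x (from≮ w≮x)

      odd-isolated-above : Parity false x → ∀ {w} → ¬ w < x → ¬ Edge (to x) w
      odd-isolated-above odd {w} w≮x e
        with Equivalence.from (π-edge x (from w)) (subst (Edge (to x)) (sym (strictlyInverseˡ w)) e)
      ... | inj₁ (_ , even)  = even-odd-disjoint even odd
      ... | inj₂ (u<x , _)   = from≮ w≮x u<x

      -- The successor `s` of `x` has parity opposite to `x`, and `s` is at most `to x`. If `s` lies
      -- below `to x`, the parity of `s` decides whether the two are adjacent; if they coincide,
      -- that parity decides whether `to x` is adjacent to its own successor `t`. In each case the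
      -- answer is opposite to what `to x` inherits from `x`.
      to≯ : ¬ x < to x
      to≯ x<z with ⋖-exists x | ⋖-exists (to x)
      ... | s , x⋖s@(x<s , x-max) | t , z⋖t@(z<t , _) with parity x | compare s (to x)
      ...   | _         | tri> _ _ z<s = x-max z<s x<z
      ...   | inj₁ even | tri< s<z s≢z _ =
        even-odd-disjoint
          (edge⇒even s<z (Graph.symmetric thresholdGraph (even-adjacent-above even (asym x<s) s≢z)))
          (successor x⋖s even)
      ...   | inj₁ even | tri≈ _ refl _ =
        even-odd-disjoint
          (edge⇒even z<t (even-adjacent-above even (asym (<-trans x<z z<t)) (λ e → irrefl (sym e) z<t)))
          (successor x⋖s even)
      ...   | inj₂ odd  | tri< s<z _ _ =
        odd-isolated-above odd (asym x<s) (inj₂ (s<z , successor x⋖s odd))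
      ...   | inj₂ odd  | tri≈ _ refl _ =
        odd-isolated-above odd (asym (<-trans x<z z<t)) (inj₁ (z<t , successor x⋖s odd))

      to≡ : to x ≡ x
      to≡ with compare (to x) x
      -- Here `to x` is itself a fixed point, so `x` and `to x` have the same image.
      ... | tri< z<x _ _ = to-injective (fixed z<x)
      ... | tri≈ _ z≡x _ = z≡x
      ... | tri> _ _ x<z = contradiction x<z to≯

    thresholdGraph-rigid : ∀ x → to x ≡ x
    thresholdGraph-rigid x = go (<-wellFounded x)
      where
      go : ∀ {x} → Acc _<_ x → to x ≡ x
      go (acc rs) = to≡ (λ y<x → go (rs y<x))

-- Groups with only the trivial automorphism have exponent 2.

module _ {ℓ} {V : Set ℓ} (G : LocallyFiniteGroup V)
         (rigid : ((π , _) : Group.Carrier (AutGroup G)) → ∀ x → Inverse.to π x ≡ x)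
  where
  open LocallyFiniteGroup G using (isGroup; rawGroup)
  group : Group ℓ ℓ
  group = record { isGroup = isGroup }

  open Group group using (_∙_; ε; _⁻¹; assoc; identityˡ; identityʳ; inverseˡ; inverseʳ; isSemigroup)
  open GroupProperties group using (⁻¹-anti-homo-∙; ⁻¹-involutive; identityˡ-unique; inverseʳ-unique)

  -- Reduces each use of rigidity to an inverse pair and multiplicativity, since preservation of `ε`
  -- and of inverses follows in a group.
  homomorphism-rigid : (f g : V → V) → (∀ x → f (g x) ≡ x) → (∀ x → g (f x) ≡ x) →
                       (∀ x y → f (x ∙ y) ≡ f x ∙ f y) → ∀ x → f x ≡ x
  homomorphism-rigid f g fg gf ∙-homo = rigid (mk↔ₛ′ f g fg gf , record
    { isMonoidHomomorphism = record
      { isMagmaHomomorphism = record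
        { isRelHomomorphism = record { cong = cong f } ; homo = ∙-homo }
      ; ε-homo = ε-homo }
    ; ⁻¹-homo = λ x → inverseʳ-unique (f x) (f (x ⁻¹))
        (trans (sym (∙-homo x (x ⁻¹))) (trans (cong f (inverseʳ x)) ε-homo)) })
    where
    ε-homo : f ε ≡ ε
    ε-homo = identityˡ-unique (f ε) (f ε) (trans (sym (∙-homo ε ε)) (cong f (identityˡ ε)))

  open ≡-Reasoning

  comm : ∀ x y → x ∙ y ≡ y ∙ x
  comm a y = begin
    a ∙ y                   ≡⟨ cancelʳ (a ∙ y) ⟨
    a ∙ y ∙ a ⁻¹ ∙ a        ≡⟨ cong (_∙ a) (homomorphism-rigid f g fg gf ∙-homo y) ⟩
    y ∙ a                   ∎
    where
    cancelʳ : ∀ x → x ∙ a ⁻¹ ∙ a ≡ x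
    cancelʳ x = trans (assoc _ _ _) (trans (cong (x ∙_) (inverseˡ a)) (identityʳ x))
    cancelˡ : ∀ x → a ⁻¹ ∙ (a ∙ x) ≡ x
    cancelˡ x = trans (sym (assoc _ _ _)) (trans (cong (_∙ x) (inverseˡ a)) (identityˡ x))
    cancelˡ′ : ∀ x → a ∙ (a ⁻¹ ∙ x) ≡ x
    cancelˡ′ x = trans (sym (assoc _ _ _)) (trans (cong (_∙ x) (inverseʳ a)) (identityˡ x))
    f g : V → V
    f x = a ∙ x ∙ a ⁻¹
    g x = a ⁻¹ ∙ (x ∙ a)
    fg : ∀ x → f (g x) ≡ x
    fg x = trans (cong (_∙ a ⁻¹) (cancelˡ′ (x ∙ a)))
                 (trans (assoc _ _ _) (trans (cong (x ∙_) (inverseʳ a)) (identityʳ x)))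
    gf : ∀ x → g (f x) ≡ x
    gf x = trans (cong (a ⁻¹ ∙_) (cancelʳ (a ∙ x))) (cancelˡ x)
    ∙-homo : ∀ x y → f (x ∙ y) ≡ f x ∙ f y
    ∙-homo x y = begin
      a ∙ (x ∙ y) ∙ a ⁻¹                ≡⟨ cong (_∙ a ⁻¹) (assoc a x y) ⟨
      a ∙ x ∙ y ∙ a ⁻¹                  ≡⟨ assoc _ _ _ ⟩
      a ∙ x ∙ (y ∙ a ⁻¹)                ≡⟨ cong (a ∙ x ∙_) (cancelˡ (y ∙ a ⁻¹)) ⟨
      a ∙ x ∙ (a ⁻¹ ∙ (a ∙ (y ∙ a ⁻¹))) ≡⟨ cong (λ z → a ∙ x ∙ (a ⁻¹ ∙ z)) (assoc a y (a ⁻¹)) ⟨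
      a ∙ x ∙ (a ⁻¹ ∙ f y)              ≡⟨ assoc _ _ _ ⟨
      f x ∙ f y                         ∎

  self-inverse : ∀ x → x ∙ x ≡ ε
  self-inverse x = trans (cong (_∙ x) (sym x⁻¹≡x)) (inverseˡ x)
    where
    x⁻¹≡x : x ⁻¹ ≡ x
    x⁻¹≡x = homomorphism-rigid _⁻¹ _⁻¹ ⁻¹-involutive ⁻¹-involutive
              (λ x y → trans (⁻¹-anti-homo-∙ x y) (comm _ _)) x

  commutativeSemigroup : CommutativeSemigroup ℓ ℓ
  commutativeSemigroup = record
    { isCommutativeSemigroup = record { isSemigroup = isSemigroup ; comm = comm } }

  open CommutativeSemigroupProperties commutativeSemigroup using (interchange; x∙yz≈y∙xz)

  cancel : ∀ x y → x ∙ (x ∙ y) ≡ y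
  cancel x y = trans (sym (assoc x x y)) (trans (cong (_∙ y) (self-inverse x)) (identityˡ y))

  -- Index-2 subgroups and transvections.

  -- A subgroup complementary to the span of `a`. Closure under inverses is automatic in exponent 2,
  -- and `coset` at `a` together with `a∉K` puts `a ∙ a`, that is `ε`, into it.
  record Complement (a : V) : Set (Level.suc ℓ) where
    field
      _∈K     : Pred V ℓ
      ∙-closed : ∀ {x y} → x ∈K → y ∈K → (x ∙ y) ∈K
      a∉K     : ¬ a ∈K
      coset   : ∀ x → x ∈K ⊎ (a ∙ x) ∈K

    quotient-closed : ∀ {x y} → x ∈K → (x ∙ y) ∈K → y ∈K
    quotient-closed x∈K xy∈K = subst _∈K (cancel _ _) (∙-closed x∈K xy∈K)

    ∉-∙-∉ : ∀ {x y} → ¬ x ∈K → ¬ y ∈K → (x ∙ y) ∈K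
    ∉-∙-∉ {x} {y} x∉K y∉K with coset x | coset y
    ... | inj₁ x∈K | _        = contradiction x∈K x∉K
    ... | inj₂ _   | inj₁ y∈K = contradiction y∈K y∉K
    ... | inj₂ ax  | inj₂ ay  = subst _∈K (trans (interchange a x a y)
        (trans (cong (_∙ (x ∙ y)) (self-inverse a)) (identityˡ _))) (∙-closed ax ay)

  module _ (em : ExcludedMiddle ℓ) where

    module _ {a v} (K : Complement a) (v∈K : Complement._∈K K v) where
      open Complement K

      transvect : ∀ x → Dec (x ∈K) → V
      transvect x (yes _) = x
      transvect x (no _)  = v ∙ x

      transvection : V → V
      transvection x = transvect x em

      transvection-outside : ∀ {x} → ¬ x ∈K → transvection x ≡ v ∙ x
      transvection-outside {x} x∉K with em {x ∈K}
      ... | yes x∈K = contradiction x∈K x∉K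
      ... | no _    = refl

      transvection-inside : ∀ {x} → x ∈K → transvection x ≡ x
      transvection-inside {x} x∈K with em {x ∈K}
      ... | yes _  = refl
      ... | no x∉K = contradiction x∈K x∉K

      transvection-involutive : ∀ x → transvection (transvection x) ≡ x
      transvection-involutive x with em {x ∈K}
      ... | yes x∈K = transvection-inside x∈K
      ... | no x∉K  = trans (transvection-outside (λ vx∈K → x∉K (quotient-closed v∈K vx∈K)))
                            (cancel v x)

      transvection-homo : ∀ x y → transvection (x ∙ y) ≡ transvection x ∙ transvection y
      transvection-homo x y with em {x ∈K} | em {y ∈K}
      ... | yes x∈K | yes y∈K = transvection-inside (∙-closed x∈K y∈K)
      ... | yes x∈K | no y∉K  =
        trans (transvection-outside (λ xy∈K → y∉K (quotient-closed x∈K xy∈K))) (x∙yz≈y∙xz v x y)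
      ... | no x∉K  | yes y∈K =
        trans (transvection-outside (λ xy∈K → x∉K (quotient-closed y∈K (subst _∈K (comm x y) xy∈K))))
              (sym (assoc v x y))
      ... | no x∉K  | no y∉K  = trans (transvection-inside (∉-∙-∉ x∉K y∉K))
        (sym (trans (interchange v x v y) (trans (cong (_∙ (x ∙ y)) (self-inverse v)) (identityˡ _))))

      -- Rigidity is evaluated at `a`, which lies outside `K` and is therefore sent to `v ∙ a`.
      v≡ε : v ≡ ε
      v≡ε = identityˡ-unique v a (trans (sym (transvection-outside a∉K))
        (homomorphism-rigid transvection transvection
          transvection-involutive transvection-involutive transvection-homo a))

    -- Every member of `K` is `ε`, so whichever of `c` and `a ∙ c` lies in `K` makes `c` equal to
    -- `ε` or to `a`.
    complement-trivial : ∀ {a c} → a ≢ c → c ≢ ε → ¬ Complement a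
    complement-trivial {a} {c} a≢c c≢ε K with Complement.coset K c
    ... | inj₁ c∈K  = c≢ε (v≡ε K c∈K)
    ... | inj₂ ac∈K = a≢c (trans (sym (trans (cong (a ∙_) (v≡ε K ac∈K)) (identityʳ a))) (cancel a c))

    -- A complement from a greedy basis over the two-element field.

    data Span (P : Pred V ℓ) : Pred V ℓ where
      gen  : ∀ {x} → P x → Span P x
      unit : Span P ε
      mult : ∀ {x y} → Span P x → Span P y → Span P (x ∙ y)

    module _ {_<_ : Rel V ℓ}
             (<-isStrictTotalOrder : IsStrictTotalOrder _≡_ _<_)
             (<-wellFounded : WellFounded _<_)
             (no-max : ∀ x → ∃[ y ] x < y)
             {a} (a≢ε : a ≢ ε)
      where
      open IsStrictTotalOrder <-isStrictTotalOrder using (compare) renaming (trans to <-trans)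

      -- The greedy choice along the well-order: these elements extend `a` to a basis of the group
      -- as a vector space over the two-element field.
      Basic : Pred V ℓ
      Basic x = ¬ Span (λ y → y ≡ a ⊎ y < x) x

      -- Products of strictly descending sequences of basic elements below x.
      data Below (x : V) : Pred V ℓ where
        unit : Below x ε
        cons : ∀ {y z} → y < x → Basic y → Below y z → Below x (y ∙ z)

      -- The inclusion of initial segments serves as the non-strict order between `x` and `x′`, here
      -- and in `Below-∙`.
      Below-mono : ∀ {x x′ w} → (∀ {y} → y < x → y < x′) → Below x w → Below x′ w
      Below-mono x≤x′ unit             = unit
      Below-mono x≤x′ (cons y<x b zs)  = cons (x≤x′ y<x) b zs

      -- As in insertion sort, `y` moves past larger factors by commutativity; on meeting an equal
      -- factor both cancel, as squares are trivial.
      insert : ∀ {x y w} → y < x → Basic y → Below x w → Below x (y ∙ w)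
      insert y<x b unit = cons y<x b unit
      insert {y = y} y<x b (cons {y′} {z} y′<x b′ zs) with compare y y′
      ... | tri< y<y′ _ _ = subst (Below _) (x∙yz≈y∙xz y′ y z) (cons y′<x b′ (insert y<y′ b zs))
      ... | tri≈ _ refl _ = subst (Below _) (sym (cancel y z)) (Below-mono (λ u<y → <-trans u<y y<x) zs)
      ... | tri> _ _ y′<y = cons y<x b (cons y′<y b′ zs)

      Below-∙ : ∀ {x x′ w w′} → (∀ {y} → y < x → y < x′) → Below x w → Below x′ w′ → Below x′ (w ∙ w′)
      Below-∙ x≤x′ unit            ws = subst (Below _) (sym (identityˡ _)) ws
      Below-∙ x≤x′ (cons y<x b zs) ws = subst (Below _) (sym (assoc _ _ _))
        (insert (x≤x′ y<x) b (Below-∙ (λ u<y → <-trans u<y (x≤x′ y<x)) zs ws))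

      Below⇒Span : ∀ {x w} → Below x w → Span (λ y → y ≡ a ⊎ y < x) w
      Below⇒Span = go λ y<x → y<x
        where
        go : ∀ {x x′ w} → (∀ {y} → y < x → y < x′) → Below x w → Span (λ y → y ≡ a ⊎ y < x′) w
        go x≤x′ unit            = unit
        go x≤x′ (cons y<x b zs) =
          mult (gen (inj₂ (x≤x′ y<x))) (go (λ u<y → <-trans u<y (x≤x′ y<x)) zs)

      -- If a descending product equals `a`, its leading factor is `a` times smaller factors, which
      -- contradicts its being basic.
      a∉Below : ∀ {x w} → Below x w → w ≢ a
      a∉Below unit ε≡a = a≢ε (sym ε≡a)
      a∉Below (cons {y} {z} _ b zs) yz≡a = b (subst (Span _) az≡y (mult (gen (inj₁ refl)) (Below⇒Span zs)))
        where
        az≡y : a ∙ z ≡ y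
        az≡y = trans (cong (_∙ z) (sym yz≡a))
                     (trans (assoc y z z) (trans (cong (y ∙_) (self-inverse z)) (identityʳ y)))

      K : Pred V ℓ
      K w = ∃[ x ] Below x w

      K-∙ : ∀ {w w′} → K w → K w′ → K (w ∙ w′)
      K-∙ (x , ws) (x′ , ws′) with compare x x′
      ... | tri< x<x′ _ _ = x′ , Below-∙ (λ u<x → <-trans u<x x<x′) ws ws′
      ... | tri≈ _ refl _ = x′ , Below-∙ (λ u<x → u<x) ws ws′
      ... | tri> _ _ x′<x = x  , Below-∙ (λ u<x → u<x) ws (Below-mono (λ u<x′ → <-trans u<x′ x′<x) ws′)

      K∪aK : Pred V ℓ
      K∪aK w = K w ⊎ K (a ∙ w)

      K∪aK-∙ : ∀ {w w′} → K∪aK w → K∪aK w′ → K∪aK (w ∙ w′)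
      K∪aK-∙ (inj₁ p) (inj₁ q) = inj₁ (K-∙ p q)
      K∪aK-∙ (inj₁ p) (inj₂ q) = inj₂ (subst K (x∙yz≈y∙xz _ _ _) (K-∙ p q))
      K∪aK-∙ (inj₂ p) (inj₁ q) = inj₂ (subst K (assoc _ _ _) (K-∙ p q))
      K∪aK-∙ (inj₂ p) (inj₂ q) = inj₁ (subst K (trans (interchange a _ a _)
        (trans (cong (_∙ _) (self-inverse a)) (identityˡ _))) (K-∙ p q))

      -- Well-founded induction: a non-basic `x` is a product of copies of `a` and smaller elements,
      -- all already covered, and `K∪aK` is closed under products.
      K∪aK-total : ∀ x → K∪aK x
      K∪aK-total x = go x (<-wellFounded x)
        where
        go : ∀ x → Acc _<_ x → K∪aK x
        go x (acc rs) with em {Span (λ y → y ≡ a ⊎ y < x) x}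
        -- The bound in `Below` is strict, so the one-factor product `x` needs some element above
        -- `x`.
        ... | no basic = inj₁ (proj₁ (no-max x) ,
          subst (Below _) (identityʳ x) (cons (proj₂ (no-max x)) basic unit))
        ... | yes x∈span = span x∈span
          where
          span : ∀ {w} → Span (λ y → y ≡ a ⊎ y < x) w → K∪aK w
          -- `a ∙ a` is the empty product, for which any bound serves; `a` is an arbitrary choice.
          span (gen (inj₁ refl)) = inj₂ (a , subst (Below a) (sym (self-inverse a)) unit)
          span (gen (inj₂ y<x))  = go _ (rs y<x)
          span unit              = inj₁ (a , unit)
          span (mult p q)        = K∪aK-∙ (span p) (span q)

      complement : Complement a
      complement = record
        { _∈K      = K
        ; ∙-closed = K-∙
        ; a∉K      = λ (_ , ws) → a∉Below ws refl
        ; coset    = K∪aK-total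
        }

-- Separating the two classes.

AutGroup-nontrivial : ∀ {ℓ} → ExcludedMiddle ℓ → (κ : InfiniteCardinal ℓ) →
  (G : LocallyFiniteGroup (InfiniteCardinal.Carrier κ)) →
  ¬ (((π , _) : Group.Carrier (AutGroup G)) → ∀ x → Inverse.to π x ≡ x)
AutGroup-nontrivial em κ G rigid = complement-trivial G rigid em (λ a≡c → irrefl a≡c a<c) c≢ε
  (complement G rigid em isStrictTotalOrder <-wellFounded (no-greatest em κ) a≢ε)
  where
  open InfiniteCardinal κ
  open LocallyFiniteGroup G using (ε)
  open IsStrictTotalOrder isStrictTotalOrder using (irrefl) renaming (trans to <-trans)
  a c : Carrier
  a = proj₁ (no-greatest em κ ε)
  c = proj₁ (no-greatest em κ a)
  ε<a : ε < a
  ε<a = proj₂ (no-greatest em κ ε)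
  a<c : a < c
  a<c = proj₂ (no-greatest em κ a)
  a≢ε : a ≢ ε
  a≢ε e = irrefl (sym e) ε<a
  c≢ε : c ≢ ε
  c≢ε e = irrefl (sym e) (<-trans ε<a a<c)

theorem1p6 : ∀ {ℓ : Level} → ExcludedMiddle ℓ → (κ : InfiniteCardinal ℓ) → ¬ (Aut-𝐊gf κ ≐ Aut-𝐊lf κ)
theorem1p6 em κ (gf⊆lf , _) = AutGroup-nontrivial em κ G rigid
  where
  open InfiniteCardinal κ
  Γ : Graph Carrier
  Γ = thresholdGraph em isStrictTotalOrder <-wellFounded (no-greatest em κ)

  Γ-rigid : (p : Group.Carrier (AutGraph Γ)) → ∀ x → Inverse.to (proj₁ p) x ≡ x
  Γ-rigid (π , π-edge) = thresholdGraph-rigid em isStrictTotalOrder <-wellFounded (no-greatest em κ) π π-edge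

  Γ-in-gf : Aut-𝐊gf κ (AutGraph Γ)
  Γ-in-gf = Γ , (λ p → p) ,
    isGroupIsomorphism (Group.rawGroup (AutGraph Γ)) (λ {p} → Group.refl (AutGraph Γ) {p})

  lf : Aut-𝐊lf κ (AutGraph Γ)
  lf = gf⊆lf {AutGraph Γ} Γ-in-gf

  G : LocallyFiniteGroup Carrier
  G = proj₁ lf

  open IsGroupIsomorphism (proj₂ (proj₂ lf)) using (surjective; ⟦⟧-cong; ε-homo)

  rigid : (q : Group.Carrier (AutGroup G)) → ∀ x → Inverse.to (proj₁ q) x ≡ x
  rigid q x with surjective q
  -- `q` is the image of some graph automorphism `p`; since `p` agrees pointwise with the identity,
  -- its image agrees with the image of the identity.
  ... | p , p↦q = trans (sym (p↦q {p} (λ _ → refl) x))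
    (trans (⟦⟧-cong {p} {Group.ε (AutGraph Γ)} (Γ-rigid p) x) (ε-homo x))
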